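{- Let $q$ be a prime power and let $n\ge 1$ and $r>2$ be integers. Let $\mathcal{S}$ be an $(n-1)$-spread of $\mathrm{PG}(rn-1,q)$ having $r$ normal elements in general position. Then $\mathcal{S}$ is projectively equivalent (i.e. equivalent under a collineation of $\mathrm{PG}(rn-1,q)$) to $\mathcal{S}_r(\mathbf{M})$ for some nearfield spread set $\mathbf{M}$.
   Context: An $(n-1)$-spread of $\mathrm{PG}(N-1,q)$ is a set of $(n-1)$-dimensional projective subspaces partitioning the point set. An element $E$ of an $(n-1)$-spread $\mathcal{S}$ of $\mathrm{PG}(rn-1,q)$ is a normal element if for every $F\in\mathcal{S}$, $F\neq E$, the $(2n-1)$-dimensional subspace $\langle E,F\rangle$ is partitioned by elements of $\mathcal{S}$. A set of $(n-1)$-spaces of $\mathrm{PG}(kn-1,q)$ is in general position if any $k$ of them span the whole space. Coordinates: points of $\mathrm{PG}(rn-1,q)$ are written $(x_1,\dots,x_r)_{\mathbb{F}_q}$ with $x_i\in\mathbb{F}_q^n$ (row vectors), not all zero, up to nonzero $\mathbb{F}_q$-scalars. For $n\times n$ matrices $A_1,\dots,A_r$ over $\mathbb{F}_q$ such that the $n\times rn$ matrix $[A_1\ \cdots\ A_r]$ has rank $n$, $(A_1,\dots,A_r)$ denotes the $(n-1)$-space $\{(xA_1,\dots,xA_r)_{\mathbb{F}_q}: x\in\mathbb{F}_q^n\setminus\{0\}\}$; $I$ and $0$ denote the identity and zero $n\times n$ matrices. A spread set is a set $\mathbf{M}$ of $q^n$ matrices of size $n\times n$ over $\mathbb{F}_q$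 such that $A-B$ is nonsingular for all distinct $A,B\in\mathbf{M}$. A nearfield spread set is a spread set containing $0$ and $I$ that is closed under matrix multiplication. For a spread set $\mathbf{M}$ containing $0$ and $I$, $\mathcal{S}_r(\mathbf{M})$ is the set of $(n-1)$-spaces $(A_1,\dots,A_r)$ with all $A_i\in\mathbf{M}$, not all $A_i$ zero, and such that the first nonzero $A_k$ equals $I$. -}

module Defs where

open import Level using (0ℓ)
open import Data.Nat as ℕ using (ℕ; zero; suc; _^_)
open import Data.Fin using (Fin)
open import Data.Vec as V using (Vec; []; _∷_)
open import Data.List as L using (List)
open import Data.List.Membership.Propositional using (_∈_)
open import Data.List.Relation.Unary.Unique.Propositional using (Unique)
open import Data.Vec.Relation.Unary.All using (All)
open import Data.Product using (Σ; ∃; _×_; _,_)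
open import Data.Sum using (_⊎_)
open import Data.Empty using (⊥)
open import Relation.Nullary using (¬_)
open import Relation.Binary.PropositionalEquality using (_≡_; _≢_)
import Algebra.Structures as AS

-- Finite fields (equality is propositional equality).
-- The order of the field is q = length elements; it is automatically a
-- prime power.

record FiniteField : Set₁ where
  infixl 6 _+_
  infixl 7 _*_
  field
    Carrier  : Set
    _+_ _*_  : Carrier → Carrier → Carrier
    -_       : Carrier → Carrier
    0# 1#    : Carrier
    isCommutativeRing : AS.IsCommutativeRing (_≡_ {A = Carrier}) _+_ _*_ -_ 0# 1#
    0≢1      : 0# ≢ 1#
    inverse  : ∀ x → x ≢ 0# → Σ Carrier (λ y → x * y ≡ 1#)
    elements : List Carrier
    complete : ∀ x → x ∈ elements
    unique   : Unique elements

  order : ℕ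
  order = L.length elements

module _ (F : FiniteField) where
  open FiniteField F

  Vector : ℕ → Set
  Vector l = Vec Carrier l

  Matrix : ℕ → ℕ → Set
  Matrix k l = Vec (Vec Carrier l) k

  zeroV : ∀ {l} → Vector l
  zeroV = V.replicate _ 0#

  _+V_ : ∀ {l} → Vector l → Vector l → Vector l
  _+V_ = V.zipWith _+_

  _·V_ : ∀ {l} → Carrier → Vector l → Vector l
  a ·V v = V.map (a *_) v

  vecMat : ∀ {k l} → Vector k → Matrix k l → Vector l
  vecMat []      []      = zeroV
  vecMat (a ∷ x) (r ∷ A) = (a ·V r) +V vecMat x A

  _*M_ : ∀ {k l m} → Matrix k l → Matrix l m → Matrix k m
  A *M B = V.map (λ row → vecMat row B) A

  _-M_ : ∀ {k l} → Matrix k l → Matrix k l → Matrix k l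
  A -M B = V.zipWith (λ a b → V.zipWith (λ x y → x + (- y)) a b) A B

  zeroM : ∀ {k l} → Matrix k l
  zeroM = V.replicate _ zeroV

  idM : ∀ {k} → Matrix k k
  idM {zero}  = []
  idM {suc k} = (1# ∷ zeroV) ∷ V.map (0# ∷_) (idM {k})

  Nonsingular : ∀ {k} → Matrix k k → Set
  Nonsingular A = Σ (Matrix _ _) (λ B → (A *M B ≡ idM) × (B *M A ≡ idM))

  FullRowRank : ∀ {k l} → Matrix k l → Set
  FullRowRank A = ∀ x → vecMat x A ≡ zeroV → x ≡ zeroV

  Nonzero : ∀ {l} → Vector l → Set
  Nonzero v = v ≢ zeroV

  _∈Row_ : ∀ {k l} → Vector l → Matrix k l → Set
  v ∈Row A = Σ (Vector _) (λ x → v ≡ vecMat x A)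

  InSpan₂ : ∀ {k l} → Vector l → Matrix k l → Matrix k l → Set
  InSpan₂ v A B = Σ (Vector _) (λ x → Σ (Vector _) (λ y → v ≡ vecMat x A +V vecMat y B))

  sumV : ∀ {r l} → (Fin r → Vector l) → Vector l
  sumV {zero}  f = zeroV
  sumV {suc r} f = f Fin.zero +V sumV (λ i → f (Fin.suc i))

  -- (n-1)-spreads of PG(N-1,q): a finite family of (n-1)-spaces (given by
  -- n × N matrices of rank n) such that every point lies in exactly one
  -- member (distinct members are therefore distinct and disjoint).

  IsSpread : ∀ {n N m} → (Fin m → Matrix n N) → Set
  IsSpread {n} {N} {m} S =
      (∀ i → FullRowRank (S i))
    × (∀ (v : Vector N) → Nonzero v →
         Σ (Fin m) (λ i → (v ∈Row S i) × (∀ j → v ∈Row S j → j ≡ i)))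

  -- normal element: for every other member F, <E,F> is partitioned by
  -- members of S, i.e. every point of <E,F> lies on a member of S
  -- contained in <E,F>.
  IsNormal : ∀ {n N m} → (Fin m → Matrix n N) → Fin m → Set
  IsNormal {n} {N} {m} S e =
    ∀ (f : Fin m) → f ≢ e →
    ∀ (v : Vector N) → Nonzero v → InSpan₂ v (S e) (S f) →
    Σ (Fin m) (λ k → (v ∈Row S k)
                   × (∀ w → w ∈Row S k → InSpan₂ w (S e) (S f)))

  -- r members (given by distinct indices) spanning PG(rn-1,q), i.e. in
  -- general position (any r of them span the whole space)
  InGeneralPosition : ∀ {n r m} → (Fin m → Matrix n (r ℕ.* n)) → (Fin r → Fin m) → Set
  InGeneralPosition {n} {r} {m} S e =
      (∀ i j → e i ≡ e j → i ≡ j)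
    × (∀ (v : Vector (r ℕ.* n)) →
         Σ (Fin r → Vector n) (λ x → v ≡ sumV (λ i → vecMat (x i) (S (e i)))))

  IsSpreadSet : ∀ {n} → List (Matrix n n) → Set
  IsSpreadSet {n} M =
      (L.length M ≡ order ^ n)
    × (∀ (i j : Fin (L.length M)) → i ≢ j →
         Nonsingular (L.lookup M i -M L.lookup M j))

  IsNearfieldSpreadSet : ∀ {n} → List (Matrix n n) → Set
  IsNearfieldSpreadSet {n} M =
      IsSpreadSet M
    × (zeroM ∈ M)
    × (idM ∈ M)
    × (∀ A B → A ∈ M → B ∈ M → (A *M B) ∈ M)

  blockRow : ∀ {n r} → Vec (Matrix n n) r → Matrix n (r ℕ.* n)
  blockRow As = V.tabulate (λ k → V.concat (V.map (λ A → V.lookup A k) As))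

  FirstNonzeroIsI : ∀ {n r} → Vec (Matrix n n) r → Set
  FirstNonzeroIsI []       = ⊥
  FirstNonzeroIsI (A ∷ As) = (A ≡ idM) ⊎ ((A ≡ zeroM) × FirstNonzeroIsI As)

  InSr : ∀ {n} (r : ℕ) → List (Matrix n n) → Matrix n (r ℕ.* n) → Set
  InSr {n} r M G =
    Σ (Vec (Matrix n n) r) (λ As →
      All (_∈ M) As × FirstNonzeroIsI As × (G ≡ blockRow As))

  _∼_ : ∀ {l} → Vector l → Vector l → Set
  v ∼ w = Σ Carrier (λ a → (a ≢ 0#) × (w ≡ a ·V v))

  Collinear : ∀ {l} → Vector l → Vector l → Vector l → Set
  Collinear u v w =
    Σ Carrier (λ a → Σ Carrier (λ b → Σ Carrier (λ c →
      ¬ (a ≡ 0# × b ≡ 0# × c ≡ 0#)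
      × ((a ·V u) +V ((b ·V v) +V (c ·V w)) ≡ zeroV))))

  -- f induces a bijection on the points of PG(N-1,q) which maps collinear
  -- triples onto collinear triples (hence lines onto lines)
  IsCollineation : ∀ {N} → (Vector N → Vector N) → Set
  IsCollineation {N} f =
      (∀ v → Nonzero v → Nonzero (f v))
    × (∀ v w → Nonzero v → Nonzero w → v ∼ w → f v ∼ f w)
    × (∀ v w → Nonzero v → Nonzero w → f v ∼ f w → v ∼ w)
    × (∀ w → Nonzero w → Σ (Vector N) (λ v → Nonzero v × f v ∼ w))
    × (∀ u v w → Nonzero u → Nonzero v → Nonzero w →
         (Collinear u v w → Collinear (f u) (f v) (f w))
       × (Collinear (f u) (f v) (f w) → Collinear u v w))

  MapsOnto : ∀ {n N} → (Vector N → Vector N) → Matrix n N → Matrix n N → Set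
  MapsOnto {n} {N} f E G =
    ∀ (w : Vector N) → Nonzero w →
      (w ∈Row G → Σ (Vector N) (λ v → Nonzero v × v ∈Row E × f v ∼ w))
    × (Σ (Vector N) (λ v → Nonzero v × v ∈Row E × f v ∼ w) → w ∈Row G)

  MapsSpreadOnto : ∀ {n N m} → (Vector N → Vector N) → (Fin m → Matrix n N)
                   → (Matrix n N → Set) → Set
  MapsSpreadOnto {n} {N} {m} f S T =
      (∀ i → Σ (Matrix n N) (λ G → T G × MapsOnto f (S i) G))
    × (∀ G → T G → Σ (Fin m) (λ i → MapsOnto f (S i) G))

{-# OPTIONS --safe #-}
module Submission where

-- Take coordinates with respect to bases of the normal elements E_a.  If u and v differ only in
-- coordinate i, normality of E_i makes the elements through u and v have the same projection along
-- E_i.  Changing coordinates one at a time, the projection of an element to two coordinates (a , b)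
-- depends only on the projection of one of its vectors.  Hence each component of an element is zero or
-- nonsingular, and the slopes A with x_b = x_a A form a spread set M_ab, the elements being exactly
-- the free combinations of slopes.  Comparing components gives A⁻¹ A′ ∈ M_bc for A ∈ M_ab nonzero and
-- A′ ∈ M_ac.  After choosing the bases so that (I , … , I) is an element, this forces all the M_ab
-- to coincide (r > 2 provides a third index) and to be closed under products.

open import Defs
open import Data.Nat using (ℕ; _≥_; _>_; _*_; zero; suc; s≤s; _^_) renaming (_+_ to _+ℕ_)
import Data.Nat.Properties as ℕₚ
open import Data.Fin using (Fin; zero; suc)
import Data.Fin.Properties as Finₚ
open import Data.Vec using (Vec; []; _∷_; map; lookup; tabulate; take; drop; concat; replicate; _++_)
import Data.Vec.Properties as Vecₚ
open import Data.Vec.Relation.Unary.All.Properties using (tabulate⁺; lookup⁺)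
open import Data.List as List using (List; []; _∷_)
import Data.List.Properties as Listₚ
open import Data.List.Membership.Propositional using (_∈_)
open import Data.List.Membership.Propositional.Properties
  using (∈-cartesianProductWith⁺; ∈-map⁺; ∈-map⁻; ∈-lookup; ∈-allFin)
open import Data.List.Relation.Unary.Any using (here; there; index)
open import Data.List.Relation.Unary.Any.Properties using (lookup-index)
open import Data.List.Relation.Unary.All as LAll using ([]; _∷_)
open import Data.List.Relation.Unary.AllPairs using ([]; _∷_)
open import Data.List.Relation.Unary.Unique.Propositional using (Unique)
open import Data.List.Relation.Unary.Unique.Propositional.Properties using (cartesianProductWith⁺)
  renaming (map⁺ to Unique-map⁺)
open import Data.Product using (Σ; ∃; _×_; _,_; proj₁; proj₂)
open import Data.Sum using (_⊎_; inj₁; inj₂)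
open import Data.Empty using (⊥-elim)
open import Function using (_∘_; id)
open import Level using (0ℓ)
open import Algebra.Bundles using (CommutativeRing)
import Algebra.Properties.Ring as RingProperties
open import Relation.Nullary using (¬_; Dec; yes; no; ¬?)
open import Relation.Nullary.Decidable using (decidable-stable)
open import Relation.Binary.Definitions using (DecidableEquality)
open import Relation.Binary.PropositionalEquality

-- Finite enumerations and index choices.

lookup-unique : ∀ {A : Set} {xs : List A} → Unique xs → ∀ i j →
  List.lookup xs i ≡ List.lookup xs j → i ≡ j
lookup-unique (_ ∷ _)  zero    zero    _  = refl
lookup-unique (p ∷ _)  zero    (suc j) eq = ⊥-elim (LAll.lookup p (∈-lookup j) eq)
lookup-unique (p ∷ _)  (suc i) zero    eq = ⊥-elim (LAll.lookup p (∈-lookup i) (sym eq))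
lookup-unique (_ ∷ ps) (suc i) (suc j) eq = cong suc (lookup-unique ps i j eq)

module Enumeration {A : Set} (xs : List A) (complete : ∀ x → x ∈ xs) (unique : Unique xs) where

  position : A → Fin (List.length xs)
  position x = index (complete x)

  lookup-position : ∀ x → x ≡ List.lookup xs (position x)
  lookup-position x = lookup-index (complete x)

  position-injective : ∀ {x y} → position x ≡ position y → x ≡ y
  position-injective {x} {y} eq =
    trans (lookup-position x) (trans (cong (List.lookup xs) eq) (sym (lookup-position y)))

  _≟_ : DecidableEquality A
  x ≟ y with position x Finₚ.≟ position y
  ... | yes eq = yes (position-injective eq)
  ... | no neq = no (neq ∘ cong position)

  abstract
    -- A value missed by f would embed 1 + |A| elements into A.
    injective⇒surjective : (f : A → A) → (∀ {x y} → f x ≡ f y → x ≡ y) → ∀ y → ∃ λ x → f x ≡ y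
    injective⇒surjective f f-inj y with Finₚ.any? (λ i → f (List.lookup xs i) ≟ y)
    ... | yes (i , eq) = List.lookup xs i , eq
    ... | no missed = ⊥-elim (ℕₚ.1+n≰n (Finₚ.injective⇒≤ {f = g} g-injective))
      where
      g : Fin (suc (List.length xs)) → Fin (List.length xs)
      g zero    = position y
      g (suc i) = position (f (List.lookup xs i))

      g-injective : ∀ {i j} → g i ≡ g j → i ≡ j
      g-injective {zero}  {zero}  _  = refl
      g-injective {zero}  {suc j} eq = ⊥-elim (missed (j , sym (position-injective eq)))
      g-injective {suc i} {zero}  eq = ⊥-elim (missed (i , position-injective eq))
      g-injective {suc i} {suc j} eq = cong suc (lookup-unique unique i j (f-inj (position-injective eq)))

  -- `s` has the left inverse `f`, so it is injective and, the set being finite, surjective. Hence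
  -- it is enough to check the claim at `x = s y`.
  rightInverse⇒leftInverse : (f s : A → A) → (∀ y → f (s y) ≡ y) → ∀ x → s (f x) ≡ x
  rightInverse⇒leftInverse f s fs x
    with injective⇒surjective s (λ {y} {z} eq → trans (sym (fs y)) (trans (cong f eq) (fs z))) x
  ... | y , refl = cong s (fs y)

length-cartesianProductWith : ∀ {A B C : Set} (f : A → B → C) xs ys →
  List.length (List.cartesianProductWith f xs ys) ≡ List.length xs * List.length ys
length-cartesianProductWith f []       ys = refl
length-cartesianProductWith f (x ∷ xs) ys = begin
  List.length (List.map (f x) ys List.++ rest)                ≡⟨ Listₚ.length-++ (List.map (f x) ys) ⟩
  List.length (List.map (f x) ys) +ℕ List.length rest
    ≡⟨ cong₂ _+ℕ_ (Listₚ.length-map (f x) ys) (length-cartesianProductWith f xs ys) ⟩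
  List.length ys +ℕ List.length xs * List.length ys           ∎
  where
  open ≡-Reasoning
  rest = List.cartesianProductWith f xs ys

-- Supplies the further coordinate through which slopes are transported and multiplied.
∃≢₂ : ∀ {r} → r > 2 → (i j : Fin r) → ∃ λ k → k ≢ i × k ≢ j
∃≢₂ (s≤s (s≤s (s≤s _))) zero          zero          = suc zero , (λ ()) , (λ ())
∃≢₂ (s≤s (s≤s (s≤s _))) zero          (suc zero)    = suc (suc zero) , (λ ()) , (λ ())
∃≢₂ (s≤s (s≤s (s≤s _))) zero          (suc (suc _)) = suc zero , (λ ()) , (λ ())
∃≢₂ (s≤s (s≤s (s≤s _))) (suc zero)    zero          = suc (suc zero) , (λ ()) , (λ ())
∃≢₂ (s≤s (s≤s (s≤s _))) (suc (suc _)) zero          = suc zero , (λ ()) , (λ ())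
∃≢₂ (s≤s (s≤s (s≤s _))) (suc _)       (suc _)       = zero , (λ ()) , (λ ())

-- Linear algebra over a finite field.

module LinearAlgebra (F : FiniteField) where
  open FiniteField F renaming (_+_ to _+ᶠ_; _*_ to _*ᶠ_; -_ to -ᶠ_)

  commutativeRing : CommutativeRing 0ℓ 0ℓ
  commutativeRing = record { isCommutativeRing = isCommutativeRing }

  open CommutativeRing commutativeRing using
    ( ring; +-assoc; +-comm; +-identityˡ; +-identityʳ; -‿inverseˡ; *-assoc; *-identityˡ; *-identityʳ
    ; distribˡ; distribʳ; zeroˡ; zeroʳ)
  open RingProperties ring using (-1*x≈-x)

  infixl 6 _⊕_
  infixr 7 _⊙_
  infixl 7 _∙_

  _⊕_ : ∀ {l} → Vector F l → Vector F l → Vector F l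
  _⊕_ = _+V_ F

  _⊙_ : ∀ {l} → Carrier → Vector F l → Vector F l
  _⊙_ = _·V_ F

  _∙_ : ∀ {k l} → Vector F k → Matrix F k l → Vector F l
  _∙_ = vecMat F

  𝟎 : ∀ {l} → Vector F l
  𝟎 = zeroV F

  ⊕-assoc : ∀ {l} (u v w : Vector F l) → (u ⊕ v) ⊕ w ≡ u ⊕ (v ⊕ w)
  ⊕-assoc = Vecₚ.zipWith-assoc +-assoc

  ⊕-comm : ∀ {l} (u v : Vector F l) → u ⊕ v ≡ v ⊕ u
  ⊕-comm = Vecₚ.zipWith-comm +-comm

  ⊕-identityˡ : ∀ {l} (u : Vector F l) → 𝟎 ⊕ u ≡ u
  ⊕-identityˡ = Vecₚ.zipWith-identityˡ +-identityˡ

  ⊕-identityʳ : ∀ {l} (u : Vector F l) → u ⊕ 𝟎 ≡ u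
  ⊕-identityʳ = Vecₚ.zipWith-identityʳ +-identityʳ

  ⊙-distribˡ : ∀ {l} a (u v : Vector F l) → a ⊙ (u ⊕ v) ≡ a ⊙ u ⊕ a ⊙ v
  ⊙-distribˡ a []      []      = refl
  ⊙-distribˡ a (x ∷ u) (y ∷ v) = cong₂ _∷_ (distribˡ a x y) (⊙-distribˡ a u v)

  ⊙-distribʳ : ∀ {l} a b (u : Vector F l) → (a +ᶠ b) ⊙ u ≡ a ⊙ u ⊕ b ⊙ u
  ⊙-distribʳ a b []      = refl
  ⊙-distribʳ a b (x ∷ u) = cong₂ _∷_ (distribʳ x a b) (⊙-distribʳ a b u)

  ⊙-assoc : ∀ {l} a b (u : Vector F l) → (a *ᶠ b) ⊙ u ≡ a ⊙ (b ⊙ u)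
  ⊙-assoc a b []      = refl
  ⊙-assoc a b (x ∷ u) = cong₂ _∷_ (*-assoc a b x) (⊙-assoc a b u)

  ⊙-identityˡ : ∀ {l} (u : Vector F l) → 1# ⊙ u ≡ u
  ⊙-identityˡ []      = refl
  ⊙-identityˡ (x ∷ u) = cong₂ _∷_ (*-identityˡ x) (⊙-identityˡ u)

  ⊙-zeroˡ : ∀ {l} (u : Vector F l) → 0# ⊙ u ≡ 𝟎
  ⊙-zeroˡ []      = refl
  ⊙-zeroˡ (x ∷ u) = cong₂ _∷_ (zeroˡ x) (⊙-zeroˡ u)

  ⊙-zeroʳ : ∀ {l} a → a ⊙ 𝟎 {l} ≡ 𝟎
  ⊙-zeroʳ {zero}  a = refl
  ⊙-zeroʳ {suc l} a = cong₂ _∷_ (zeroʳ a) (⊙-zeroʳ a)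

  -- Written as a scalar multiple, so that linear maps commute with it by `⊙-homo`.
  ⊖_ : ∀ {l} → Vector F l → Vector F l
  ⊖ u = (-ᶠ 1#) ⊙ u

  ⊕-inverseˡ : ∀ {l} (u : Vector F l) → (⊖ u) ⊕ u ≡ 𝟎
  ⊕-inverseˡ []      = refl
  ⊕-inverseˡ (x ∷ u) =
    cong₂ _∷_ (trans (cong (_+ᶠ x) (-1*x≈-x x)) (-‿inverseˡ x)) (⊕-inverseˡ u)

  ⊕-inverseʳ : ∀ {l} (u : Vector F l) → u ⊕ (⊖ u) ≡ 𝟎
  ⊕-inverseʳ u = trans (⊕-comm u (⊖ u)) (⊕-inverseˡ u)

  ⊕-⊖-cancel : ∀ {l} (u v : Vector F l) → (u ⊕ (⊖ v)) ⊕ v ≡ u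
  ⊕-⊖-cancel u v = begin
    (u ⊕ (⊖ v)) ⊕ v ≡⟨ ⊕-assoc u (⊖ v) v ⟩
    u ⊕ ((⊖ v) ⊕ v) ≡⟨ cong (u ⊕_) (⊕-inverseˡ v) ⟩
    u ⊕ 𝟎           ≡⟨ ⊕-identityʳ u ⟩
    u               ∎
    where open ≡-Reasoning

  ⊕-interchange : ∀ {l} (s t u v : Vector F l) → (s ⊕ t) ⊕ (u ⊕ v) ≡ (s ⊕ u) ⊕ (t ⊕ v)
  ⊕-interchange s t u v = begin
    (s ⊕ t) ⊕ (u ⊕ v) ≡⟨ ⊕-assoc s t (u ⊕ v) ⟩
    s ⊕ (t ⊕ (u ⊕ v)) ≡⟨ cong (s ⊕_) (⊕-assoc t u v) ⟨
    s ⊕ ((t ⊕ u) ⊕ v) ≡⟨ cong (λ w → s ⊕ (w ⊕ v)) (⊕-comm t u) ⟩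
    s ⊕ ((u ⊕ t) ⊕ v) ≡⟨ cong (s ⊕_) (⊕-assoc u t v) ⟩
    s ⊕ (u ⊕ (t ⊕ v)) ≡⟨ ⊕-assoc s u (t ⊕ v) ⟨
    (s ⊕ u) ⊕ (t ⊕ v) ∎
    where open ≡-Reasoning

  record Linear {k l} (h : Vector F k → Vector F l) : Set where
    field
      ⊕-homo : ∀ u v → h (u ⊕ v) ≡ h u ⊕ h v
      ⊙-homo : ∀ a u → h (a ⊙ u) ≡ a ⊙ h u

    𝟎-homo : h 𝟎 ≡ 𝟎
    𝟎-homo = trans (cong h (sym (⊙-zeroˡ 𝟎))) (trans (⊙-homo 0# 𝟎) (⊙-zeroˡ (h 𝟎)))

    trivialKernel⇒injective : (∀ u → h u ≡ 𝟎 → u ≡ 𝟎) → ∀ {u v} → h u ≡ h v → u ≡ v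
    trivialKernel⇒injective kernel {u} {v} eq = begin
      u               ≡⟨ ⊕-⊖-cancel u v ⟨
      (u ⊕ (⊖ v)) ⊕ v ≡⟨ cong (_⊕ v) (kernel (u ⊕ (⊖ v)) difference) ⟩
      𝟎 ⊕ v           ≡⟨ ⊕-identityˡ v ⟩
      v               ∎
      where
      open ≡-Reasoning
      difference : h (u ⊕ (⊖ v)) ≡ 𝟎
      difference = begin
        h (u ⊕ (⊖ v))   ≡⟨ ⊕-homo u (⊖ v) ⟩
        h u ⊕ h (⊖ v)   ≡⟨ cong₂ _⊕_ eq (⊙-homo (-ᶠ 1#) v) ⟩
        h v ⊕ (⊖ (h v)) ≡⟨ ⊕-inverseʳ (h v) ⟩
        𝟎               ∎

  open Linear

  ∘-linear : ∀ {j k l} {g : Vector F k → Vector F l} {h : Vector F j → Vector F k} →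
    Linear g → Linear h → Linear (g ∘ h)
  ∘-linear {g = g} G H = record
    { ⊕-homo = λ u v → trans (cong g (⊕-homo H u v)) (⊕-homo G _ _)
    ; ⊙-homo = λ a u → trans (cong g (⊙-homo H a u)) (⊙-homo G a _)
    }

  inverse-linear : ∀ {l} {g h : Vector F l → Vector F l} → Linear g →
    (∀ u → g (h u) ≡ u) → (∀ u → h (g u) ≡ u) → Linear h
  inverse-linear {g = g} {h} G gh hg = record
    { ⊕-homo = λ u v → trans (cong h (trans (cong₂ _⊕_ (sym (gh u)) (sym (gh v))) (sym (⊕-homo G _ _)))) (hg _)
    ; ⊙-homo = λ a u → trans (cong h (trans (cong (a ⊙_) (sym (gh u))) (sym (⊙-homo G a _)))) (hg _)
    }

  ∙-linear : ∀ {k l} (A : Matrix F k l) → Linear (_∙ A)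
  ∙-linear A = record { ⊕-homo = add A ; ⊙-homo = scale A }
    where
    open ≡-Reasoning
    add : ∀ {k l} (A : Matrix F k l) u v → (u ⊕ v) ∙ A ≡ u ∙ A ⊕ v ∙ A
    add []      []      []      = sym (⊕-identityˡ 𝟎)
    add (r ∷ A) (x ∷ u) (y ∷ v) = begin
      (x +ᶠ y) ⊙ r ⊕ (u ⊕ v) ∙ A            ≡⟨ cong₂ _⊕_ (⊙-distribʳ x y r) (add A u v) ⟩
      (x ⊙ r ⊕ y ⊙ r) ⊕ (u ∙ A ⊕ v ∙ A)     ≡⟨ ⊕-interchange (x ⊙ r) (y ⊙ r) (u ∙ A) (v ∙ A) ⟩
      (x ⊙ r ⊕ u ∙ A) ⊕ (y ⊙ r ⊕ v ∙ A)     ∎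

    scale : ∀ {k l} (A : Matrix F k l) a u → (a ⊙ u) ∙ A ≡ a ⊙ (u ∙ A)
    scale []      a []      = sym (⊙-zeroʳ a)
    scale (r ∷ A) a (x ∷ u) = begin
      (a *ᶠ x) ⊙ r ⊕ (a ⊙ u) ∙ A            ≡⟨ cong₂ _⊕_ (⊙-assoc a x r) (scale A a u) ⟩
      a ⊙ x ⊙ r ⊕ a ⊙ (u ∙ A)               ≡⟨ ⊙-distribˡ a (x ⊙ r) (u ∙ A) ⟨
      a ⊙ (x ⊙ r ⊕ u ∙ A)                   ∎

  𝟎∙ : ∀ {k l} (A : Matrix F k l) → 𝟎 ∙ A ≡ 𝟎
  𝟎∙ A = 𝟎-homo (∙-linear A)

  -- `x ∙ A` is a linear combination of the rows of `A`, so `h` passes through it. Instances are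
  -- matrix products, the blocks of `blockRow` and the components of spread elements.
  ∙-map : ∀ {j k l} {h : Vector F k → Vector F l} → Linear h →
    (x : Vector F j) (A : Matrix F j k) → x ∙ map h A ≡ h (x ∙ A)
  ∙-map H []      []      = sym (𝟎-homo H)
  ∙-map H (a ∷ x) (r ∷ A) = trans
    (cong₂ _⊕_ (sym (⊙-homo H a r)) (∙-map H x A))
    (sym (⊕-homo H (a ⊙ r) (x ∙ A)))

  ∙-*M : ∀ {j k l} (x : Vector F j) (A : Matrix F j k) (B : Matrix F k l) →
    x ∙ _*M_ F A B ≡ (x ∙ A) ∙ B
  ∙-*M x A B = ∙-map (∙-linear B) x A

  0∷-linear : ∀ {l} → Linear {l} (0# ∷_)
  0∷-linear = record
    { ⊕-homo = λ u v → cong (_∷ (u ⊕ v)) (sym (+-identityˡ 0#))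
    ; ⊙-homo = λ a u → cong (_∷ (a ⊙ u)) (sym (zeroʳ a))
    }

  ∙-idM : ∀ {l} (x : Vector F l) → x ∙ idM F ≡ x
  ∙-idM []      = refl
  ∙-idM (a ∷ x) = begin
    a ⊙ (1# ∷ 𝟎) ⊕ x ∙ map (0# ∷_) (idM F)  ≡⟨ cong (a ⊙ (1# ∷ 𝟎) ⊕_) (∙-map 0∷-linear x (idM F)) ⟩
    (a *ᶠ 1# +ᶠ 0#) ∷ (a ⊙ 𝟎 ⊕ x ∙ idM F)
      ≡⟨ cong₂ _∷_ (trans (+-identityʳ _) (*-identityʳ a))
           (trans (cong₂ _⊕_ (⊙-zeroʳ a) (∙-idM x)) (⊕-identityˡ x)) ⟩
    a ∷ x ∎
    where open ≡-Reasoning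

  idM-*M : ∀ {k l} (A : Matrix F k l) → _*M_ F (idM F) A ≡ A
  idM-*M []      = refl
  idM-*M (r ∷ A) = cong₂ _∷_ first rest
    where
    open ≡-Reasoning
    first : 1# ⊙ r ⊕ 𝟎 ∙ A ≡ r
    first = trans (cong₂ _⊕_ (⊙-identityˡ r) (𝟎∙ A)) (⊕-identityʳ r)

    rest : map (_∙ (r ∷ A)) (map (0# ∷_) (idM F)) ≡ A
    rest = begin
      map (_∙ (r ∷ A)) (map (0# ∷_) (idM F)) ≡⟨ Vecₚ.map-∘ (_∙ (r ∷ A)) (0# ∷_) (idM F) ⟨
      map (λ x → 0# ⊙ r ⊕ x ∙ A) (idM F)
        ≡⟨ Vecₚ.map-cong (λ x → trans (cong (_⊕ x ∙ A) (⊙-zeroˡ r)) (⊕-identityˡ (x ∙ A))) (idM F) ⟩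
      map (_∙ A) (idM F)                     ≡⟨ idM-*M A ⟩
      A                                      ∎

  -- The rows of `idM` serve as test vectors and compare the matrices row by row.
  matrix-ext : ∀ {k l} (A B : Matrix F k l) → (∀ x → x ∙ A ≡ x ∙ B) → A ≡ B
  matrix-ext A B eq = trans (sym (idM-*M A)) (trans (Vecₚ.map-cong eq (idM F)) (idM-*M B))

  ∙-zeroM : ∀ {k l} (x : Vector F k) → x ∙ zeroM F {k} {l} ≡ 𝟎
  ∙-zeroM []      = refl
  ∙-zeroM (a ∷ x) = trans (cong₂ _⊕_ (⊙-zeroʳ a) (∙-zeroM x)) (⊕-identityˡ 𝟎)

  -- The additive form avoids comparing the field negation inside `_-M_` with the scalar multiple
  -- `⊖_`.
  ∙--M : ∀ {k l} (x : Vector F k) (A B : Matrix F k l) → x ∙ _-M_ F A B ⊕ x ∙ B ≡ x ∙ A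
  ∙--M []      []      []      = ⊕-identityˡ 𝟎
  ∙--M (a ∷ x) (r ∷ A) (s ∷ B) = begin
    (a ⊙ d ⊕ x ∙ D) ⊕ (a ⊙ s ⊕ x ∙ B) ≡⟨ ⊕-interchange (a ⊙ d) (x ∙ D) (a ⊙ s) (x ∙ B) ⟩
    (a ⊙ d ⊕ a ⊙ s) ⊕ (x ∙ D ⊕ x ∙ B)
      ≡⟨ cong₂ _⊕_ (trans (sym (⊙-distribˡ a d s)) (cong (a ⊙_) (cancel r s))) (∙--M x A B) ⟩
    a ⊙ r ⊕ x ∙ A                     ∎
    where
    open ≡-Reasoning
    d = Data.Vec.zipWith (λ y z → y +ᶠ (-ᶠ z)) r s
    D = _-M_ F A B
    cancel : ∀ {l} (r s : Vector F l) → Data.Vec.zipWith (λ y z → y +ᶠ (-ᶠ z)) r s ⊕ s ≡ r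
    cancel []      []      = refl
    cancel (y ∷ r) (z ∷ s) = cong₂ _∷_
      (trans (+-assoc y (-ᶠ z) z) (trans (cong (y +ᶠ_) (-‿inverseˡ z)) (+-identityʳ y)))
      (cancel r s)

  -- Enumeration of vectors and nonsingular matrices.

  vectors : ∀ l → List (Vector F l)
  vectors zero    = [] ∷ []
  vectors (suc l) = List.cartesianProductWith _∷_ elements (vectors l)

  vectors-complete : ∀ {l} (v : Vector F l) → v ∈ vectors l
  vectors-complete []      = here refl
  vectors-complete (a ∷ v) = ∈-cartesianProductWith⁺ _∷_ (complete a) (vectors-complete v)

  vectors-unique : ∀ l → Unique (vectors l)
  vectors-unique zero    = [] ∷ []
  vectors-unique (suc l) = cartesianProductWith⁺ _∷_ Vecₚ.∷-injective unique (vectors-unique l)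

  length-vectors : ∀ l → List.length (vectors l) ≡ order ^ l
  length-vectors zero    = refl
  length-vectors (suc l) = trans
    (length-cartesianProductWith _∷_ elements (vectors l)) (cong (order *_) (length-vectors l))

  module Vectors {l} = Enumeration (vectors l) vectors-complete (vectors-unique l)
  open Vectors using (injective⇒surjective; rightInverse⇒leftInverse) renaming (_≟_ to _≟ᵛ_) public

  abstract
    -- Multiplication by `A` is injective on a finite set, hence surjective. The rows of the inverse
    -- are preimages of the rows of `idM`.
    trivialKernel⇒nonsingular : ∀ {l} (A : Matrix F l l) → (∀ x → x ∙ A ≡ 𝟎 → x ≡ 𝟎) → Nonsingular F A
    trivialKernel⇒nonsingular {l} A kernel = B , AB≡I , BA≡I
      where
      open ≡-Reasoning
      injective : ∀ {x y} → x ∙ A ≡ y ∙ A → x ≡ y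
      injective = trivialKernel⇒injective (∙-linear A) kernel

      preimage : ∀ y → ∃ λ x → x ∙ A ≡ y
      preimage = injective⇒surjective (_∙ A) injective
      B : Matrix F l l
      B = map (proj₁ ∘ preimage) (idM F)

      BA≡I : _*M_ F B A ≡ idM F
      BA≡I = begin
        map (_∙ A) (map (proj₁ ∘ preimage) (idM F)) ≡⟨ Vecₚ.map-∘ (_∙ A) (proj₁ ∘ preimage) (idM F) ⟨
        map (λ y → proj₁ (preimage y) ∙ A) (idM F)  ≡⟨ Vecₚ.map-cong (proj₂ ∘ preimage) (idM F) ⟩
        map id (idM F)                              ≡⟨ Vecₚ.map-id (idM F) ⟩
        idM F                                       ∎

      AB≡I : _*M_ F A B ≡ idM F
      -- Cancel the injective right multiplication by `A` in `(A B) A = A (B A) = A`.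
      AB≡I = matrix-ext _ _ λ x → injective (begin
        (x ∙ _*M_ F A B) ∙ A   ≡⟨ cong (_∙ A) (∙-*M x A B) ⟩
        ((x ∙ A) ∙ B) ∙ A      ≡⟨ ∙-*M (x ∙ A) B A ⟨
        (x ∙ A) ∙ _*M_ F B A   ≡⟨ cong ((x ∙ A) ∙_) BA≡I ⟩
        (x ∙ A) ∙ idM F        ≡⟨ ∙-idM (x ∙ A) ⟩
        x ∙ A                  ≡⟨ cong (_∙ A) (∙-idM x) ⟨
        (x ∙ idM F) ∙ A        ∎)

  ∙-inverse : ∀ {l} {A B : Matrix F l l} → _*M_ F A B ≡ idM F → ∀ x → (x ∙ A) ∙ B ≡ x
  ∙-inverse {A = A} {B} AB≡I x = trans (sym (∙-*M x A B)) (trans (cong (x ∙_) AB≡I) (∙-idM x))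

  -- Sums, blocks, leading entries and linear collineations.

  sumV-cong : ∀ {r l} {f g : Fin r → Vector F l} → (∀ i → f i ≡ g i) → sumV F f ≡ sumV F g
  sumV-cong {zero}  eq = refl
  sumV-cong {suc r} eq = cong₂ _⊕_ (eq zero) (sumV-cong (eq ∘ suc))

  sumV-⊕ : ∀ {r l} (f g : Fin r → Vector F l) → sumV F (λ i → f i ⊕ g i) ≡ sumV F f ⊕ sumV F g
  sumV-⊕ {zero}  f g = sym (⊕-identityˡ 𝟎)
  sumV-⊕ {suc r} f g = trans
    (cong (f zero ⊕ g zero ⊕_) (sumV-⊕ (f ∘ suc) (g ∘ suc))) (⊕-interchange _ _ _ _)

  sumV-⊙ : ∀ {r l} a (f : Fin r → Vector F l) → sumV F (λ i → a ⊙ f i) ≡ a ⊙ sumV F f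
  sumV-⊙ {zero}  a f = sym (⊙-zeroʳ a)
  sumV-⊙ {suc r} a f = trans (cong (a ⊙ f zero ⊕_) (sumV-⊙ a (f ∘ suc))) (sym (⊙-distribˡ a _ _))

  sumV-zero : ∀ {r l} {f : Fin r → Vector F l} → (∀ i → f i ≡ 𝟎) → sumV F f ≡ 𝟎
  sumV-zero {zero}  eq = refl
  sumV-zero {suc r} eq = trans (cong₂ _⊕_ (eq zero) (sumV-zero (eq ∘ suc))) (⊕-identityˡ 𝟎)

  sumV-single : ∀ {r l} {f : Fin r → Vector F l} i → (∀ j → j ≢ i → f j ≡ 𝟎) → sumV F f ≡ f i
  sumV-single {f = f} zero eq = trans
    (cong (f zero ⊕_) (sumV-zero (λ j → eq (suc j) (λ ())))) (⊕-identityʳ (f zero))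
  sumV-single (suc i) eq = trans
    (cong₂ _⊕_ (eq zero (λ ())) (sumV-single i (λ j j≢i → eq (suc j) (j≢i ∘ Finₚ.suc-injective))))
    (⊕-identityˡ _)

  -- The recursion follows the unfolding of `suc r * n` to `n + r * n`, so no cast between lengths
  -- occurs.
  block : ∀ {n r} → Vector F (r * n) → Fin r → Vector F n
  block {n} {suc r} v zero    = take n v
  block {n} {suc r} v (suc i) = block (drop n v) i

  block-linear : ∀ {n r} (i : Fin r) → Linear (λ (v : Vector F (r * n)) → block {n} v i)
  block-linear {n} {suc r} zero = record
    { ⊕-homo = Vecₚ.take-zipWith _+ᶠ_ ; ⊙-homo = λ a → Vecₚ.take-map (a *ᶠ_) n }
  block-linear {n} {suc r} (suc i) = ∘-linear (block-linear {n} {r} i) record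
    { ⊕-homo = Vecₚ.drop-zipWith _+ᶠ_ ; ⊙-homo = λ a → Vecₚ.drop-map (a *ᶠ_) n }

  block-ext : ∀ {n r} {u v : Vector F (r * n)} → (∀ i → block {n} {r} u i ≡ block v i) → u ≡ v
  block-ext {n} {zero}  {[]} {[]} eq = refl
  block-ext {n} {suc r} {u}  {v}  eq = begin
    u                      ≡⟨ Vecₚ.take++drop≡id n u ⟨
    take n u ++ drop n u   ≡⟨ cong₂ _++_ (eq zero) (block-ext {n} {r} (eq ∘ suc)) ⟩
    take n v ++ drop n v   ≡⟨ Vecₚ.take++drop≡id n v ⟩
    v                      ∎
    where open ≡-Reasoning

  block-concat : ∀ {n r} (xss : Vec (Vector F n) r) i → block (concat xss) i ≡ lookup xss i
  -- Splitting the vector and joining it again changes nothing; injectivity of `++` then identifies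
  -- the `take` and the `drop` part at once.
  block-concat {n} (xs ∷ xss) i with Vecₚ.++-injective (take n (xs ++ concat xss)) xs
                                       (Vecₚ.take++drop≡id n (xs ++ concat xss))
  block-concat (xs ∷ xss) zero    | eq , _  = eq
  block-concat (xs ∷ xss) (suc i) | _  , eq = trans (cong (λ v → block v i) eq) (block-concat xss i)

  block-∙-blockRow : ∀ {n r} (As : Vec (Matrix F n n) r) x i →
    block (x ∙ blockRow F As) i ≡ x ∙ lookup As i
  block-∙-blockRow {n} {r} As x i = begin
    block (x ∙ blockRow F As) i                ≡⟨ ∙-map (block-linear {n} {r} i) x (blockRow F As) ⟨
    x ∙ map (λ v → block v i) (blockRow F As)  ≡⟨ cong (x ∙_) rows ⟩
    x ∙ lookup As i                            ∎
    where
    open ≡-Reasoning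
    row : Fin n → Vector F (r * n)
    row k = concat (map (λ A → lookup A k) As)
    rows : map (λ v → block {n} {r} v i) (tabulate row) ≡ lookup As i
    rows = begin
      map (λ v → block v i) (tabulate row) ≡⟨ Vecₚ.tabulate-∘ (λ v → block v i) row ⟨
      tabulate (λ k → block (row k) i)
        ≡⟨ Vecₚ.tabulate-cong (λ k → trans (block-concat (map (λ A → lookup A k) As) i)
                                           (Vecₚ.lookup-map i (λ A → lookup A k) As)) ⟩
      tabulate (lookup (lookup As i))      ≡⟨ Vecₚ.tabulate∘lookup (lookup As i) ⟩
      lookup As i                          ∎

  -- `a` is the least index satisfying `P`. The last component is quantified over `As` because the
  -- matrices will be slopes from `a`, which can be formed only once `a` is known.
  leading-entry : ∀ {l t} {P : Fin t → Set} → (∀ b → Dec (P b)) → ∃ P → ∃ λ a → P a ×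
    ((As : Vec (Matrix F l l) t) → lookup As a ≡ idM F → (∀ b → ¬ P b → lookup As b ≡ zeroM F) →
     FirstNonzeroIsI F As)
  leading-entry {t = suc t} P? (b , Pb) with P? zero
  leading-entry P? (b     , Pb) | yes P0 = zero , P0 , λ { (A ∷ As) eq _ → inj₁ eq }
  leading-entry P? (zero  , P0) | no ¬P0 = ⊥-elim (¬P0 P0)
  leading-entry P? (suc b , Pb) | no ¬P0 =
    let a , Pa , first = leading-entry (P? ∘ suc) (b , Pb)
    in suc a , Pa , λ { (A ∷ As) eq vanish → inj₂ (vanish zero ¬P0 , first As eq (vanish ∘ suc)) }

  leading-index : ∀ {l t} (As : Vec (Matrix F l l) t) → FirstNonzeroIsI F As → ∃ λ a → lookup As a ≡ idM F
  leading-index (A ∷ As) (inj₁ eq)          = zero , eq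
  leading-index (A ∷ As) (inj₂ (_ , first)) = let a , eq = leading-index As first in suc a , eq

  -- A linear bijection carries a dependence relation to the one with the same coefficients, and its
  -- injectivity brings relations back.
  linearBijection⇒collineation : ∀ {N} (f g : Vector F N → Vector F N) → Linear f →
    (∀ v → f (g v) ≡ v) → (∀ v → g (f v) ≡ v) → IsCollineation F f
  linearBijection⇒collineation f g L fg gf =
      (λ v v≢0 fv≡0 → v≢0 (injective (trans fv≡0 (sym (𝟎-homo L)))))
    , (λ { v _ _ _ (a , a≢0 , refl) → a , a≢0 , ⊙-homo L a v })
    , (λ { v w _ _ (a , a≢0 , eq) → a , a≢0 , injective (trans eq (sym (⊙-homo L a v))) })
    , (λ w w≢0 → g w , (λ gw≡0 → w≢0 (trans (sym (fg w)) (trans (cong f gw≡0) (𝟎-homo L))))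
                 , 1# , (0≢1 ∘ sym) , trans (sym (fg w)) (sym (⊙-identityˡ _)))
    , λ u v w _ _ _ →
        (λ (a , b , c , nontrivial , eq) → a , b , c , nontrivial ,
           trans (sym (combination a b c u v w)) (trans (cong f eq) (𝟎-homo L)))
      , (λ (a , b , c , nontrivial , eq) → a , b , c , nontrivial ,
           injective (trans (combination a b c u v w) (trans eq (sym (𝟎-homo L)))))
    where
    injective : ∀ {u v} → f u ≡ f v → u ≡ v
    injective {u} {v} eq = trans (sym (gf u)) (trans (cong g eq) (gf v))

    combination : ∀ a b c u v w →
      f (a ⊙ u ⊕ (b ⊙ v ⊕ c ⊙ w)) ≡ a ⊙ f u ⊕ (b ⊙ f v ⊕ c ⊙ f w)
    combination a b c u v w = trans (⊕-homo L _ _)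
      (cong₂ _⊕_ (⊙-homo L a u) (trans (⊕-homo L _ _) (cong₂ _⊕_ (⊙-homo L b v) (⊙-homo L c w))))

-- B is a choice of bases of the normal elements; γ v a is the a-th component of v in these bases.
module Coordinates (F : FiniteField) {n r m : ℕ} (S : Fin m → Matrix F n (r * n)) (isSpread : IsSpread F S)
  (e : Fin r → Fin m) (normal : ∀ i → IsNormal F S (e i))
  (B : Fin r → Matrix F n (r * n))
  (B⊆E : ∀ a x → _∈Row_ F (vecMat F x (B a)) (S (e a)))
  (E⊆B : ∀ a x → _∈Row_ F (vecMat F x (S (e a))) (B a))
  (spanning : ∀ v → Σ (Fin r → Vector F n) (λ x → v ≡ sumV F (λ a → vecMat F (x a) (B a)))) where

  open LinearAlgebra F
  open Linear

  -- Coordinates in the chosen bases.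

  V W : Set
  V = Vector F (r * n)
  W = Vector F n

  _∈ₛ_ : V → Fin m → Set
  v ∈ₛ k = _∈Row_ F v (S k)

  combine : V → V
  combine w = sumV F (λ a → block {n} {r} w a ∙ B a)

  combine-linear : Linear combine
  combine-linear = record
    { ⊕-homo = λ u v → trans (sumV-cong (λ a → ⊕-homo (summand a) u v)) (sumV-⊕ {r} _ _)
    ; ⊙-homo = λ c u → trans (sumV-cong (λ a → ⊙-homo (summand a) c u)) (sumV-⊙ {r} c _)
    }
    where
    summand : ∀ a → Linear (λ w → block {n} {r} w a ∙ B a)
    summand a = ∘-linear (∙-linear (B a)) (block-linear {n} {r} a)

  block-tabulate : ∀ (X : Fin r → W) a → block (concat (tabulate X)) a ≡ X a
  block-tabulate X a = trans (block-concat (tabulate X) a) (Vecₚ.lookup∘tabulate X a)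

  assemble : (Fin r → W) → V
  assemble X = combine (concat (tabulate X))

  assemble-sum : ∀ X → assemble X ≡ sumV F (λ a → X a ∙ B a)
  assemble-sum X = sumV-cong (λ a → cong (_∙ B a) (block-tabulate X a))

  coordinates : V → V
  coordinates v = concat (tabulate (proj₁ (spanning v)))

  combine-coordinates : ∀ v → combine (coordinates v) ≡ v
  combine-coordinates v = trans (assemble-sum (proj₁ (spanning v))) (sym (proj₂ (spanning v)))

  -- Spanning alone makes `coordinates` a section of `combine`. Finiteness turns it into a two-sided
  -- inverse, so expressions in the bases are unique.
  coordinates-combine : ∀ w → coordinates (combine w) ≡ w
  coordinates-combine = rightInverse⇒leftInverse combine coordinates combine-coordinates

  coordinates-linear : Linear coordinates
  coordinates-linear = inverse-linear combine-linear combine-coordinates coordinates-combine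

  abstract
    γ : V → Fin r → W
    γ v a = block (coordinates v) a

    block-coordinates : ∀ v a → block (coordinates v) a ≡ γ v a
    block-coordinates v a = refl

    γ-linear : ∀ a → Linear (λ v → γ v a)
    γ-linear a = ∘-linear (block-linear {n} {r} a) coordinates-linear

    γ-ext : ∀ {u v} → (∀ a → γ u a ≡ γ v a) → u ≡ v
    γ-ext {u} {v} eq = trans (sym (combine-coordinates u))
      (trans (cong combine (block-ext {n} {r} eq)) (combine-coordinates v))

    γ-expand : ∀ v → v ≡ sumV F (λ a → γ v a ∙ B a)
    γ-expand v = sym (combine-coordinates v)

    γ-assemble : ∀ X a → γ (assemble X) a ≡ X a
    γ-assemble X a =
      trans (cong (λ w → block w a) (coordinates-combine (concat (tabulate X)))) (block-tabulate X a)

  γ-𝟎 : ∀ a → γ 𝟎 a ≡ 𝟎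
  γ-𝟎 a = 𝟎-homo (γ-linear a)

  γ≢𝟎⇒≢𝟎 : ∀ {v a} → γ v a ≢ 𝟎 → v ≢ 𝟎
  γ≢𝟎⇒≢𝟎 {a = a} γ≢𝟎 refl = γ≢𝟎 (γ-𝟎 a)

  abstract
    nonzero-coordinate : ∀ {v} → v ≢ 𝟎 → ∃ λ a → γ v a ≢ 𝟎
    nonzero-coordinate {v} v≢𝟎 = Finₚ.¬∀⟶∃¬ r (λ a → γ v a ≡ 𝟎) (λ a → γ v a ≟ᵛ 𝟎)
      (λ all𝟎 → v≢𝟎 (γ-ext (λ a → trans (all𝟎 a) (sym (γ-𝟎 a)))))

  supported⇒basis : ∀ {v} i → (∀ c → c ≢ i → γ v c ≡ 𝟎) → v ≡ γ v i ∙ B i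
  supported⇒basis {v} i outside = trans (γ-expand v)
    (sumV-single i (λ c c≢i → trans (cong (_∙ B c) (outside c c≢i)) (𝟎∙ (B c))))

  abstract
    -- The family with value `x` at `i` and zero elsewhere assembles to `x ∙ B i`, and `γ` recovers
    -- a family from its assembly.
    γ-basis : ∀ i x → γ (x ∙ B i) i ≡ x × (∀ c → c ≢ i → γ (x ∙ B i) c ≡ 𝟎)
    γ-basis i x = trans (transport i) single-same , λ c c≢i → trans (transport c) (single-other c c≢i)
      where
      single : Fin r → W
      single c with c Finₚ.≟ i
      ... | yes _ = x
      ... | no  _ = 𝟎

      single-same : single i ≡ x
      single-same with i Finₚ.≟ i
      ... | yes _   = refl
      ... | no  i≢i = ⊥-elim (i≢i refl)

      single-other : ∀ c → c ≢ i → single c ≡ 𝟎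
      single-other c c≢i with c Finₚ.≟ i
      ... | yes c≡i = ⊥-elim (c≢i c≡i)
      ... | no  _   = refl

      assemble-single : assemble single ≡ x ∙ B i
      assemble-single = trans
        (supported⇒basis i (λ c c≢i → trans (γ-assemble single c) (single-other c c≢i)))
        (cong (_∙ B i) (trans (γ-assemble single i) single-same))

      transport : ∀ c → γ (x ∙ B i) c ≡ single c
      transport c = trans (cong (λ v → γ v c) (sym assemble-single)) (γ-assemble single c)

  -- Spread elements in coordinates and the effect of normality.

  γ-normal : ∀ {i v} → v ∈ₛ e i → ∀ c → c ≢ i → γ v c ≡ 𝟎
  γ-normal {i} (x , refl) c c≢i with E⊆B i x
  ... | y , eq = trans (cong (λ v → γ v c) eq) (proj₂ (γ-basis i y) c c≢i)

  -- Together with `γ-normal`, this identifies the element `e i` with the coordinate subspace of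
  -- index `i`.
  supported⇒normal : ∀ {v} i → (∀ c → c ≢ i → γ v c ≡ 𝟎) → v ∈ₛ e i
  supported⇒normal {v} i outside = subst (_∈ₛ e i) (sym (supported⇒basis i outside)) (B⊆E i (γ v i))

  ∈ₛ-unique : ∀ {v k l} → v ≢ 𝟎 → v ∈ₛ k → v ∈ₛ l → k ≡ l
  ∈ₛ-unique {v} v≢𝟎 v∈k v∈l with proj₂ isSpread v v≢𝟎
  ... | _ , _ , only = trans (only _ v∈k) (sym (only _ v∈l))

  abstract
    -- The nonzero entry makes the assembled vector a point, and the spread covers every point.
    realise : ∀ (X : Fin r → W) {a} → X a ≢ 𝟎 → ∃ λ k → ∃ λ v → v ∈ₛ k × (∀ c → γ v c ≡ X c)
    realise X {a} Xa≢𝟎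
      with proj₂ isSpread (assemble X) (γ≢𝟎⇒≢𝟎 (λ eq → Xa≢𝟎 (trans (sym (γ-assemble X a)) eq)))
    ... | k , v∈k , _ = k , assemble X , v∈k , γ-assemble X

  -- v lies in the span of u and of the normal element e i, hence so does the whole element through v.
  abstract
    project-along : ∀ {i a k l u v} → a ≢ i → u ∈ₛ k → v ∈ₛ l → γ u a ≢ 𝟎 →
      (∀ c → c ≢ i → γ u c ≡ γ v c) →
      ∀ {y} → y ∈ₛ l → ∃ λ y′ → y′ ∈ₛ k × (∀ c → c ≢ i → γ y c ≡ γ y′ c)
    project-along {i} {a} {k} {l} {u} {v} a≢i (z , u≡) v∈l ua≢𝟎 agree {y} y∈l
      with supported⇒normal i difference
      where
      difference : ∀ c → c ≢ i → γ (v ⊕ (⊖ u)) c ≡ 𝟎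
      difference c c≢i = begin
        γ (v ⊕ (⊖ u)) c     ≡⟨ ⊕-homo (γ-linear c) v (⊖ u) ⟩
        γ v c ⊕ γ (⊖ u) c   ≡⟨ cong₂ _⊕_ (sym (agree c c≢i)) (⊙-homo (γ-linear c) _ u) ⟩
        γ u c ⊕ (⊖ (γ u c)) ≡⟨ ⊕-inverseʳ (γ u c) ⟩
        𝟎                   ∎
        where open ≡-Reasoning
    ... | x , d≡
      -- `k` is not `e i`, since `u` is nonzero at `a`, which differs from `i`. Normality is applied
      -- to `v = (v - u) + u`, a vector of the span of `e i` and `k`.
      with normal i k (λ { refl → ua≢𝟎 (γ-normal (z , u≡) a a≢i) }) v
             (γ≢𝟎⇒≢𝟎 (λ eq → ua≢𝟎 (trans (agree a a≢i) eq)))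
             (x , z , trans (sym (⊕-⊖-cancel v u)) (cong₂ _⊕_ d≡ u≡))
    ... | k′ , v∈k′ , inside
      with ∈ₛ-unique (γ≢𝟎⇒≢𝟎 (λ eq → ua≢𝟎 (trans (agree a a≢i) eq))) v∈l v∈k′
    ... | refl with inside y y∈l
    -- Dropping the summand in `e i` affects the coordinate `i` only.
    ... | p , q , y≡ = q ∙ S k , (q , refl) , λ c c≢i → begin
      γ y c                                  ≡⟨ cong (λ w → γ w c) y≡ ⟩
      γ (p ∙ S (e i) ⊕ q ∙ S k) c            ≡⟨ ⊕-homo (γ-linear c) _ _ ⟩
      γ (p ∙ S (e i)) c ⊕ γ (q ∙ S k) c      ≡⟨ cong (_⊕ γ (q ∙ S k) c) (γ-normal (p , refl) c c≢i) ⟩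
      𝟎 ⊕ γ (q ∙ S k) c                      ≡⟨ ⊕-identityˡ _ ⟩
      γ (q ∙ S k) c                          ∎
      where open ≡-Reasoning

  -- u is turned into v by changing one coordinate outside {a , b} at a time; xs lists the
  -- coordinates still to be changed.
  project-list : ∀ (xs : List (Fin r)) {a b k l u v} → u ∈ₛ k → v ∈ₛ l →
    γ u a ≢ 𝟎 → γ u a ≡ γ v a → γ u b ≡ γ v b → (∀ c → ¬ c ∈ xs → γ u c ≡ γ v c) →
    ∀ {y} → y ∈ₛ l → ∃ λ y′ → y′ ∈ₛ k × γ y a ≡ γ y′ a × γ y b ≡ γ y′ b
  project-list [] {u = u} u∈k v∈l ua≢𝟎 _ _ agree {y} y∈l
    with γ-ext {u} (λ c → agree c (λ ()))
  ... | refl with ∈ₛ-unique (γ≢𝟎⇒≢𝟎 ua≢𝟎) u∈k v∈l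
  ... | refl = y , y∈l , refl , refl
  project-list (i ∷ xs) {a} {b} {k} {l} {u} {v} u∈k v∈l ua≢𝟎 eqa eqb agree y∈l
    -- At `a` and `b` the vectors agree already, so these indices are simply struck from the list.
    with i Finₚ.≟ a | i Finₚ.≟ b
  ... | yes refl | _        = project-list xs u∈k v∈l ua≢𝟎 eqa eqb agree′ y∈l
    where
    agree′ : ∀ c → ¬ c ∈ xs → γ u c ≡ γ v c
    agree′ c c∉xs with c Finₚ.≟ i
    ... | yes refl = eqa
    ... | no  c≢i  = agree c λ { (here c≡i) → c≢i c≡i ; (there c∈xs) → c∉xs c∈xs }
  ... | no _     | yes refl = project-list xs u∈k v∈l ua≢𝟎 eqa eqb agree′ y∈l
    where
    agree′ : ∀ c → ¬ c ∈ xs → γ u c ≡ γ v c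
    agree′ c c∉xs with c Finₚ.≟ i
    ... | yes refl = eqb
    ... | no  c≢i  = agree c λ { (here c≡i) → c≢i c≡i ; (there c∈xs) → c∉xs c∈xs }
  ... | no i≢a   | no i≢b   = composite
    where
    -- The intermediate point is `u` with its coordinate `i` taken from `v`. The recursive call
    -- carries `y` to the element through this point, and `project-along` carries it on to `k`.
    X : Fin r → W
    X c with c Finₚ.≟ i
    ... | yes _ = γ v c
    ... | no  _ = γ u c

    X-other : ∀ c → c ≢ i → X c ≡ γ u c
    X-other c c≢i with c Finₚ.≟ i
    ... | yes c≡i = ⊥-elim (c≢i c≡i)
    ... | no  _   = refl

    X-agree : ∀ c → ¬ c ∈ xs → X c ≡ γ v c
    X-agree c c∉xs with c Finₚ.≟ i
    ... | yes _   = refl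
    ... | no  c≢i = agree c λ { (here c≡i) → c≢i c≡i ; (there c∈xs) → c∉xs c∈xs }

    composite : ∃ λ y′ → y′ ∈ₛ k × γ _ a ≡ γ y′ a × γ _ b ≡ γ y′ b
    composite with realise X {a} (λ eq → ua≢𝟎 (trans (sym (X-other a (i≢a ∘ sym))) eq))
    ... | k′ , w , w∈k′ , γw≡X
      with project-list xs {a} {b} w∈k′ v∈l
             (λ eq → ua≢𝟎 (trans (sym (trans (γw≡X a) (X-other a (i≢a ∘ sym)))) eq))
             (trans (trans (γw≡X a) (X-other a (i≢a ∘ sym))) eqa)
             (trans (trans (γw≡X b) (X-other b (i≢b ∘ sym))) eqb)
             (λ c c∉xs → trans (γw≡X c) (X-agree c c∉xs)) y∈l
    ... | y₁ , y₁∈k′ , eqa₁ , eqb₁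
      with project-along (i≢a ∘ sym) u∈k w∈k′ ua≢𝟎
             (λ c c≢i → sym (trans (γw≡X c) (X-other c c≢i))) y₁∈k′
    ... | y₂ , y₂∈k , eq₂ =
      y₂ , y₂∈k , trans eqa₁ (eq₂ a (i≢a ∘ sym)) , trans eqb₁ (eq₂ b (i≢b ∘ sym))

  abstract
    -- With every index on the list, agreement off the list is vacuous. As `u` and `v` may be
    -- exchanged, the two elements have the same projection to the coordinates `a` and `b`.
    project : ∀ {a b k l u v} → u ∈ₛ k → v ∈ₛ l → γ u a ≢ 𝟎 → γ u a ≡ γ v a → γ u b ≡ γ v b →
      ∀ {y} → y ∈ₛ l → ∃ λ y′ → y′ ∈ₛ k × γ y a ≡ γ y′ a × γ y b ≡ γ y′ b
    project u∈k v∈l ua≢𝟎 eqa eqb =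
      project-list (List.allFin r) u∈k v∈l ua≢𝟎 eqa eqb (λ c c∉ → ⊥-elim (c∉ (∈-allFin c)))

  -- Let `c` be a coordinate at which `v` is nonzero. The normal element `e c` has a vector with the
  -- same entries as `v` at `c` and `a`, so by `project` the entries of `k` at `a` occur in `e c`,
  -- where they are zero.
  vanishing : ∀ {a k v} → v ∈ₛ k → v ≢ 𝟎 → γ v a ≡ 𝟎 → ∀ {y} → y ∈ₛ k → γ y a ≡ 𝟎
  vanishing {a} {k} {v} v∈k v≢𝟎 va≡𝟎 y∈k =
    let c , vc≢𝟎      = nonzero-coordinate v≢𝟎
        same , other  = γ-basis c (γ v c)
        a≢c           = λ { refl → vc≢𝟎 va≡𝟎 }
        y′ , y′∈ , _ , eqa = project {c} {a} (B⊆E c (γ v c)) v∈k (λ eq → vc≢𝟎 (trans (sym same) eq)) same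
                               (trans (other a a≢c) (sym va≡𝟎)) y∈k
    in trans eqa (γ-normal y′∈ a a≢c)

  -- Components and slopes of spread elements.

  component : Fin m → Fin r → Matrix F n n
  component k a = map (λ v → γ v a) (S k)

  ∙-component : ∀ x k a → x ∙ component k a ≡ γ (x ∙ S k) a
  ∙-component x k a = ∙-map (γ-linear a) x (S k)

  Projects : Fin m → Fin r → Set
  Projects k a = ∃ λ v → v ∈ₛ k × γ v a ≢ 𝟎

  abstract
    -- As `S k` has full rank, a nonzero kernel vector would give a nonzero vector of `k` with entry
    -- zero at `a`. By `vanishing` all of `k` would then be zero there.
    component-nonsingular : ∀ {k a} → Projects k a → Nonsingular F (component k a)
    component-nonsingular {k} {a} (v , v∈k , va≢𝟎) = trivialKernel⇒nonsingular _ λ x xC≡𝟎 →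
      decidable-stable (x ≟ᵛ 𝟎) λ x≢𝟎 → va≢𝟎 (vanishing (x , refl)
        (λ xS≡𝟎 → x≢𝟎 (proj₁ isSpread k x xS≡𝟎)) (trans (sym (∙-component x k a)) xC≡𝟎) v∈k)

  abstract
    lift : ∀ {k a} → Projects k a → ∀ w → ∃ λ v → v ∈ₛ k × γ v a ≡ w
    lift {k} {a} p w =
      let D , _ , DC≡I = component-nonsingular p
      in (w ∙ D) ∙ S k , (w ∙ D , refl) ,
         trans (sym (∙-component (w ∙ D) k a)) (∙-inverse {A = D} {component k a} DC≡I w)

  HasSlope : Fin m → Fin r → Fin r → Matrix F n n → Set
  HasSlope k a b A = ∀ v → v ∈ₛ k → γ v b ≡ γ v a ∙ A

  abstract
    -- The slope is the quotient of the component at `b` by the nonsingular component at `a`.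
    slope : ∀ {k a} → Projects k a → ∀ b → ∃ (HasSlope k a b)
    slope {k} {a} p b =
      let D , CD≡I , _ = component-nonsingular p
      in _*M_ F D (component k b) , λ { _ (x , refl) → sym (begin
        γ (x ∙ S k) a ∙ _*M_ F D (component k b)       ≡⟨ cong (_∙ _*M_ F D (component k b)) (∙-component x k a) ⟨
        (x ∙ component k a) ∙ _*M_ F D (component k b) ≡⟨ ∙-*M (x ∙ component k a) D (component k b) ⟩
        ((x ∙ component k a) ∙ D) ∙ component k b
          ≡⟨ cong (_∙ component k b) (∙-inverse {A = component k a} {D} CD≡I x) ⟩
        x ∙ component k b                              ≡⟨ ∙-component x k b ⟩
        γ (x ∙ S k) b                                  ∎) }
      where open ≡-Reasoning

  -- The set `M_ab` of slopes, as a predicate. The case `a = b` is allowed, and there the only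
  -- possible slope is `idM`.
  Slope : Fin r → Fin r → Matrix F n n → Set
  Slope a b A = ∃ λ k → Projects k a × HasSlope k a b A

  -- Both elements contain a vector with entries `x` at `a` and `x ∙ A` at `b`. By `project` their
  -- projections coincide, and these are the graphs of `A` and `A′`.
  slope-determined : ∀ {a b A A′ x} → Slope a b A → Slope a b A′ → x ≢ 𝟎 → x ∙ A ≡ x ∙ A′ → A ≡ A′
  slope-determined {a} {b} {A} {A′} {x} (k , pk , sk) (l , pl , sl) x≢𝟎 eq = matrix-ext A A′ same
    where
    open ≡-Reasoning
    same : ∀ w → w ∙ A ≡ w ∙ A′
    same w =
      let u , u∈k , ua≡x = lift pk x
          v , v∈l , va≡x = lift pl x
          y , y∈l , ya≡w = lift pl w
          ub≡vb : γ u b ≡ γ v b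
          ub≡vb = trans (sk u u∈k) (trans (cong (_∙ A) ua≡x) (trans eq (sym (trans (sl v v∈l) (cong (_∙ A′) va≡x)))))
          y′ , y′∈k , eqa , eqb = project {a} {b} u∈k v∈l (λ ua≡𝟎 → x≢𝟎 (trans (sym ua≡x) ua≡𝟎))
                                    (trans ua≡x (sym va≡x)) ub≡vb y∈l
      in begin
        w ∙ A       ≡⟨ cong (_∙ A) (trans (sym ya≡w) eqa) ⟩
        γ y′ a ∙ A  ≡⟨ sk y′ y′∈k ⟨
        γ y′ b      ≡⟨ eqb ⟨
        γ y b       ≡⟨ sl y y∈l ⟩
        γ y a ∙ A′  ≡⟨ cong (_∙ A′) ya≡w ⟩
        w ∙ A′      ∎

  -- One vector is enough: the slope that `k` has from `a` to `b` agrees with `A` at `γ v a`, and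
  -- `slope-determined` makes them equal.
  has-slope : ∀ {k a b v A} → v ∈ₛ k → γ v a ≢ 𝟎 → γ v b ≡ γ v a ∙ A → Slope a b A → HasSlope k a b A
  has-slope {k} {a} {b} {v} {A} v∈k va≢𝟎 vb≡ s =
    let p = v , v∈k , va≢𝟎
        D , sD = slope p b
    in subst (HasSlope k a b)
         (slope-determined (k , p , sD) s va≢𝟎 (trans (sym (sD v v∈k)) vb≡)) sD

  -- Take the element through `x ∙ B a ⊕ y ∙ B b`. With `slope-determined`, exactly one slope sends
  -- `x` to `y`.
  slope-exists : ∀ {a b x} → a ≢ b → x ≢ 𝟎 → ∀ y → ∃ λ A → Slope a b A × x ∙ A ≡ y
  slope-exists {a} {b} {x} a≢b x≢𝟎 y =
    let k , v , v∈k , γv≡ = realise (γ u) {a} (λ ua≡𝟎 → x≢𝟎 (trans (sym ua≡x) ua≡𝟎))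
        va≡x = trans (γv≡ a) ua≡x
        p = v , v∈k , λ va≡𝟎 → x≢𝟎 (trans (sym va≡x) va≡𝟎)
        A , s = slope p b
    in A , (k , p , s) ,
       trans (cong (_∙ A) (sym va≡x)) (trans (sym (s v v∈k)) (trans (γv≡ b) ub≡y))
    where
    u : V
    u = x ∙ B a ⊕ y ∙ B b

    ua≡x : γ u a ≡ x
    ua≡x = trans (⊕-homo (γ-linear a) _ _)
      (trans (cong₂ _⊕_ (proj₁ (γ-basis a x)) (proj₂ (γ-basis b y) a a≢b)) (⊕-identityʳ x))

    ub≡y : γ u b ≡ y
    ub≡y = trans (⊕-homo (γ-linear b) _ _)
      (trans (cong₂ _⊕_ (proj₂ (γ-basis a x) b (a≢b ∘ sym)) (proj₁ (γ-basis b y))) (⊕-identityˡ y))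

  -- Realised by the normal element `e a`; `x` supplies a nonzero vector of it.
  slope-zero : ∀ {a b x} → x ≢ 𝟎 → a ≢ b → Slope a b (zeroM F)
  slope-zero {a} {b} {x} x≢𝟎 a≢b =
    e a , (x ∙ B a , B⊆E a x , λ eq → x≢𝟎 (trans (sym (proj₁ (γ-basis a x))) eq)) ,
    λ v v∈ → trans (γ-normal v∈ b (a≢b ∘ sym)) (sym (∙-zeroM (γ v a)))

  -- The same element, read with the two coordinates exchanged.
  slope-inverse : ∀ {a b A A⁻} → _*M_ F A A⁻ ≡ idM F → Slope a b A → Slope b a A⁻
  slope-inverse {a} {b} {A} {A⁻} AA⁻≡I (k , (v , v∈k , va≢𝟎) , s) =
    k , (v , v∈k , λ vb≡𝟎 → va≢𝟎 (trans (inverse-slope v v∈k) (trans (cong (_∙ A⁻) vb≡𝟎) (𝟎∙ A⁻)))) , inverse-slope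
    where
    inverse-slope : HasSlope k b a A⁻
    inverse-slope w w∈k = trans (sym (∙-inverse {A = A} {A⁻} AA⁻≡I (γ w a))) (cong (_∙ A⁻) (sym (s w w∈k)))

  -- The element through the point with entries `x ∙ A b` works: its entry at `a` is `x`, and
  -- `has-slope` applies to each `b`. Thus slopes combine freely.
  simultaneous-slopes : ∀ {a x} (A : Fin r → Matrix F n n) → x ≢ 𝟎 → A a ≡ idM F → (∀ b → Slope a b (A b)) →
    ∃ λ k → Projects k a × (∀ b → HasSlope k a b (A b))
  simultaneous-slopes {a} {x} A x≢𝟎 Aa≡I s =
    let k , v , v∈k , γv≡ = realise (λ b → x ∙ A b) {a} (λ eq → x≢𝟎 (trans (sym xAa≡x) eq))
        va≡x = trans (γv≡ a) xAa≡x
        va≢𝟎 = λ va≡𝟎 → x≢𝟎 (trans (sym va≡x) va≡𝟎)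
    in k , (v , v∈k , va≢𝟎) ,
       λ b → has-slope v∈k va≢𝟎 (trans (γv≡ b) (cong (_∙ A b) (sym va≡x))) (s b)
    where
    xAa≡x : x ∙ A a ≡ x
    xAa≡x = trans (cong (x ∙_) Aa≡I) (∙-idM x)

  -- Some element has slopes `A` to `b` and `A′` to `c`. On it, `x_c = x_a A′ = x_b A⁻ A′`.
  slope-quotient : ∀ {a b c A A⁻ A′ x} → x ≢ 𝟎 → a ≢ b → a ≢ c → b ≢ c → _*M_ F A A⁻ ≡ idM F →
    Slope a a (idM F) → Slope a b A → Slope a c A′ → Slope b c (_*M_ F A⁻ A′)
  slope-quotient {a} {b} {c} {A} {A⁻} {A′} x≢𝟎 a≢b a≢c b≢c AA⁻≡I sI sA sA′ =
    let k , (v , v∈k , va≢𝟎) , s = simultaneous-slopes D x≢𝟎 Da≡I sD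
        sb : HasSlope k a b A
        sb = subst (HasSlope k a b) Db≡A (s b)
        sc : HasSlope k a c A′
        sc = subst (HasSlope k a c) Dc≡A′ (s c)
        _ , p , s⁻ = slope-inverse {a} {b} AA⁻≡I (k , (v , v∈k , va≢𝟎) , sb)
    in k , p , λ w w∈k → begin
      γ w c                     ≡⟨ sc w w∈k ⟩
      γ w a ∙ A′                ≡⟨ cong (_∙ A′) (s⁻ w w∈k) ⟩
      (γ w b ∙ A⁻) ∙ A′         ≡⟨ ∙-*M (γ w b) A⁻ A′ ⟨
      γ w b ∙ _*M_ F A⁻ A′      ∎
    where
    open ≡-Reasoning
    -- Outside `a`, `b` and `c` the slope can be chosen freely; zero is always available.
    D : Fin r → Matrix F n n
    D d with d Finₚ.≟ b | d Finₚ.≟ c | d Finₚ.≟ a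
    ... | yes _ | _     | _     = A
    ... | no _  | yes _ | _     = A′
    ... | no _  | no _  | yes _ = idM F
    ... | no _  | no _  | no _  = zeroM F

    Da≡I : D a ≡ idM F
    Da≡I with a Finₚ.≟ b | a Finₚ.≟ c | a Finₚ.≟ a
    ... | yes eq | _      | _      = ⊥-elim (a≢b eq)
    ... | no _   | yes eq | _      = ⊥-elim (a≢c eq)
    ... | no _   | no _   | yes _  = refl
    ... | no _   | no _   | no neq = ⊥-elim (neq refl)

    Db≡A : D b ≡ A
    Db≡A with b Finₚ.≟ b
    ... | yes _  = refl
    ... | no neq = ⊥-elim (neq refl)

    Dc≡A′ : D c ≡ A′
    Dc≡A′ with c Finₚ.≟ b | c Finₚ.≟ c
    ... | yes eq | _      = ⊥-elim (b≢c (sym eq))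
    ... | no _   | yes _  = refl
    ... | no _   | no neq = ⊥-elim (neq refl)

    sD : ∀ d → Slope a d (D d)
    sD d with d Finₚ.≟ b | d Finₚ.≟ c | d Finₚ.≟ a
    ... | yes refl | _        | _        = sA
    ... | no _     | yes refl | _        = sA′
    ... | no _     | no _     | yes refl = sI
    ... | no _     | no _     | no d≢a   = slope-zero x≢𝟎 (d≢a ∘ sym)

  -- On `k`, the map `coordinates` sends `v` to `γ v a ∙ blockRow F As`, and by `lift` the entry
  -- `γ v a` takes every value.
  coordinates-mapsOnto : ∀ {k a} → Projects k a → (As : Vec (Matrix F n n) r) →
    (∀ b → HasSlope k a b (lookup As b)) → MapsOnto F coordinates (S k) (blockRow F As)
  coordinates-mapsOnto {k} {a} p As s w w≢𝟎 =
      (λ (x , w≡) →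
        let v , v∈k , va≡x = lift p x
            fv≡w : coordinates v ≡ w
            fv≡w = trans (on-element v∈k) (trans (cong (_∙ blockRow F As) va≡x) (sym w≡))
        in v , (λ v≡𝟎 → w≢𝟎 (trans (sym fv≡w) (trans (cong coordinates v≡𝟎) (𝟎-homo coordinates-linear)))) , v∈k
         , 1# , (0≢1 ∘ sym) , trans (sym fv≡w) (sym (⊙-identityˡ _)))
    , (λ (v , _ , v∈k , c , _ , w≡) → c ⊙ γ v a ,
        trans w≡ (trans (cong (c ⊙_) (on-element v∈k)) (sym (⊙-homo (∙-linear (blockRow F As)) c (γ v a)))))
    where
    open FiniteField F using (1#; 0≢1)
    on-element : ∀ {v} → v ∈ₛ k → coordinates v ≡ γ v a ∙ blockRow F As
    on-element {v} v∈k = block-ext {n} {r} λ b →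
      trans (block-coordinates v b) (trans (s b v v∈k) (sym (block-∙-blockRow As (γ v a) b)))

  -- Slope sets when all of them contain the identity.

  module Normalised (r>2 : r > 2) {x₁ : W} (x₁≢𝟎 : x₁ ≢ 𝟎) (unit : ∀ a b → Slope a b (idM F))
    {a₀ b₀ : Fin r} (a₀≢b₀ : a₀ ≢ b₀) where

    -- At a nonzero kernel vector `A` agrees with the slope zero, so `slope-determined` applies.
    zero-or-nonsingular : ∀ {a b A} → a ≢ b → Slope a b A → A ≡ zeroM F ⊎ Nonsingular F A
    zero-or-nonsingular {A = A} a≢b s with Vecₚ.≡-dec _≟ᵛ_ A (zeroM F)
    ... | yes A≡0 = inj₁ A≡0
    ... | no  A≢0 = inj₂ (trivialKernel⇒nonsingular A λ x xA≡𝟎 → decidable-stable (x ≟ᵛ 𝟎) λ x≢𝟎 →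
      A≢0 (slope-determined s (slope-zero x₁≢𝟎 a≢b) x≢𝟎 (trans xA≡𝟎 (sym (∙-zeroM x)))))

    difference-nonsingular : ∀ {a b A A′} → Slope a b A → Slope a b A′ → A ≢ A′ → Nonsingular F (_-M_ F A A′)
    difference-nonsingular {A = A} {A′} s s′ A≢A′ = trivialKernel⇒nonsingular _ λ x xD≡𝟎 →
      decidable-stable (x ≟ᵛ 𝟎) λ x≢𝟎 → A≢A′ (slope-determined s s′ x≢𝟎
        (trans (sym (∙--M x A A′)) (trans (cong (_⊕ x ∙ A′) xD≡𝟎) (⊕-identityˡ _))))

    -- This is `slope-quotient` with the slope `idM` from `a` to `b`.
    shift-source : ∀ {a b c A} → a ≢ c → b ≢ c → Slope a c A → Slope b c A
    shift-source {a} {b} {c} {A} a≢c b≢c s with a Finₚ.≟ b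
    ... | yes refl = s
    ... | no a≢b   = subst (Slope b c) (idM-*M A)
      (slope-quotient x₁≢𝟎 a≢b a≢c b≢c (idM-*M (idM F)) (unit a a) (unit a b) s)

    -- Inversion exchanges source and target and so reduces this to `shift-source`; the slope zero
    -- is treated apart.
    shift-target : ∀ {a b c A} → a ≢ b → a ≢ c → Slope a b A → Slope a c A
    shift-target a≢b a≢c s with zero-or-nonsingular a≢b s
    ... | inj₁ refl                    = slope-zero x₁≢𝟎 a≢c
    ... | inj₂ (A⁻ , AA⁻≡I , A⁻A≡I) =
      slope-inverse A⁻A≡I (shift-source (a≢b ∘ sym) (a≢c ∘ sym) (slope-inverse AA⁻≡I s))

    -- With `i` different from `b` and `b′`, move along `(a , b)`, `(i , b)`, `(i , b′)`,
    -- `(a′ , b′)`, changing one index at a time.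
    transfer : ∀ {a b a′ b′ A} → a ≢ b → a′ ≢ b′ → Slope a b A → Slope a′ b′ A
    transfer {b = b} {b′ = b′} a≢b a′≢b′ s =
      let i , i≢b , i≢b′ = ∃≢₂ r>2 b b′
      in shift-source i≢b′ a′≢b′ (shift-target i≢b i≢b′ (shift-source a≢b i≢b s))

    -- For nonsingular `A`, view `A A′` as the quotient of `A′`, a slope from `b` to a third index
    -- `c`, by `A⁻`, a slope from `b` to `a`. This gives a slope from `a` to `c`, which is
    -- transferred back.
    slope-product : ∀ {a b A A′} → a ≢ b → Slope a b A → Slope a b A′ → Slope a b (_*M_ F A A′)
    slope-product {a} {b} {A} {A′} a≢b s s′ with zero-or-nonsingular a≢b s
    ... | inj₁ refl = subst (Slope a b) (matrix-ext _ _ 0A′≡0) (slope-zero x₁≢𝟎 a≢b)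
      where
      0A′≡0 : ∀ x → x ∙ zeroM F ≡ x ∙ _*M_ F (zeroM F) A′
      0A′≡0 x = trans (∙-zeroM x) (sym (trans (∙-*M x (zeroM F) A′) (trans (cong (_∙ A′) (∙-zeroM x)) (𝟎∙ A′))))
    ... | inj₂ (A⁻ , AA⁻≡I , A⁻A≡I) =
      let c , c≢a , c≢b = ∃≢₂ r>2 a b
      in transfer (c≢a ∘ sym) a≢b
           (slope-quotient x₁≢𝟎 (a≢b ∘ sym) (c≢b ∘ sym) (c≢a ∘ sym) A⁻A≡I (unit b b)
             (slope-inverse AA⁻≡I s) (transfer a≢b (c≢b ∘ sym) s′))

    -- The nearfield spread set and the equivalence.

    abstract
      matrixAt : ∀ y → ∃ λ A → Slope a₀ b₀ A × x₁ ∙ A ≡ y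
      matrixAt = slope-exists a₀≢b₀ x₁≢𝟎

    -- Slopes are indexed by the image of `x₁`, which takes each value in `W` exactly once. This
    -- gives `order ^ n` distinct matrices.
    spreadSet : List (Matrix F n n)
    spreadSet = List.map (proj₁ ∘ matrixAt) (vectors n)

    ∈⇒Slope : ∀ {A} → A ∈ spreadSet → Slope a₀ b₀ A
    ∈⇒Slope A∈ with ∈-map⁻ (proj₁ ∘ matrixAt) A∈
    ... | y , _ , refl = proj₁ (proj₂ (matrixAt y))

    Slope₀⇒∈ : ∀ {A} → Slope a₀ b₀ A → A ∈ spreadSet
    Slope₀⇒∈ {A} s =
      let A′ , s′ , x₁A′≡ = matrixAt (x₁ ∙ A)
      in subst (_∈ spreadSet) (slope-determined s′ s x₁≢𝟎 x₁A′≡)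
           (∈-map⁺ (proj₁ ∘ matrixAt) (vectors-complete (x₁ ∙ A)))

    spreadSet-unique : Unique spreadSet
    spreadSet-unique = Unique-map⁺ (λ {y} {z} eq →
      trans (sym (proj₂ (proj₂ (matrixAt y)))) (trans (cong (x₁ ∙_) eq) (proj₂ (proj₂ (matrixAt z)))))
      (vectors-unique n)

    isNearfieldSpreadSet : IsNearfieldSpreadSet F spreadSet
    isNearfieldSpreadSet =
        ( trans (Listₚ.length-map (proj₁ ∘ matrixAt) (vectors n)) (length-vectors n)
        , λ i j i≢j → difference-nonsingular (∈⇒Slope (∈-lookup i)) (∈⇒Slope (∈-lookup j))
                        (i≢j ∘ lookup-unique spreadSet-unique i j) )
      , Slope₀⇒∈ (slope-zero x₁≢𝟎 a₀≢b₀)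
      , Slope₀⇒∈ (unit a₀ b₀)
      , λ A A′ A∈ A′∈ → Slope₀⇒∈ (slope-product a₀≢b₀ (∈⇒Slope A∈) (∈⇒Slope A′∈))

    Slope⇒∈ : ∀ {a b A} → Slope a b A → A ∈ spreadSet
    Slope⇒∈ {a} {b} s with a Finₚ.≟ b
    Slope⇒∈ s | no a≢b = Slope₀⇒∈ (transfer a≢b a₀≢b₀ s)
    -- A slope from a coordinate to itself fixes the nonzero vector `γ v a`, so it equals `idM`.
    Slope⇒∈ s@(_ , (v , v∈k , va≢𝟎) , sA) | yes refl =
      subst (_∈ spreadSet) (slope-determined (unit _ _) s va≢𝟎 (trans (∙-idM (γ v _)) (sA v v∈k)))
        (Slope₀⇒∈ (unit a₀ b₀))

    -- Slopes are taken from the first coordinate at which `v` is nonzero. The slope to that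
    -- coordinate itself is `idM` and those to earlier ones are zero, as the normal form requires.
    element⇒InSr : ∀ k → Σ (Matrix F n (r * n)) λ G → InSr F r spreadSet G × MapsOnto F coordinates (S k) G
    element⇒InSr k =
      let a , va≢𝟎 , first = leading-entry (λ b → ¬? (γ v b ≟ᵛ 𝟎)) (nonzero-coordinate v≢𝟎)
          p = v , v∈k , va≢𝟎
          As = tabulate (λ b → proj₁ (slope p b))
          s : ∀ b → HasSlope k a b (lookup As b)
          s b = subst (HasSlope k a b) (sym (Vecₚ.lookup∘tabulate (proj₁ ∘ slope p) b))
                  (proj₂ (slope p b))
      in blockRow F As
       , (As
         , tabulate⁺ (λ b → Slope⇒∈ (k , p , proj₂ (slope p b)))
         , first As
             (slope-determined (k , p , s a) (unit a a) va≢𝟎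
               (trans (sym (s a v v∈k)) (sym (∙-idM _))))
             (λ b ¬vb≢𝟎 → let vb≡𝟎 = decidable-stable (γ v b ≟ᵛ 𝟎) ¬vb≢𝟎 in
               slope-determined (k , p , s b)
                 (slope-zero x₁≢𝟎 (λ { refl → va≢𝟎 vb≡𝟎 })) va≢𝟎
                 (trans (sym (s b v v∈k)) (trans vb≡𝟎 (sym (∙-zeroM (γ v a))))))
         , refl)
       , coordinates-mapsOnto p As s
      where
      v : V
      v = x₁ ∙ S k

      v∈k : v ∈ₛ k
      v∈k = x₁ , refl

      v≢𝟎 : v ≢ 𝟎
      v≢𝟎 v≡𝟎 = x₁≢𝟎 (proj₁ isSpread k x₁ v≡𝟎)

    -- A position holding `idM` serves as source; `transfer` makes the other entries slopes from it,
    -- and `simultaneous-slopes` finds the element.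
    InSr⇒element : ∀ G → InSr F r spreadSet G → Σ (Fin m) λ k → MapsOnto F coordinates (S k) G
    InSr⇒element _ (As , As∈ , first , refl) =
      let a , Aa≡I = leading-index As first
          k , p , s = simultaneous-slopes (lookup As) x₁≢𝟎 Aa≡I (slopes a Aa≡I)
      in k , coordinates-mapsOnto p As s
      where
      slopes : ∀ a → lookup As a ≡ idM F → ∀ b → Slope a b (lookup As b)
      slopes a Aa≡I b with a Finₚ.≟ b
      ... | yes refl = subst (Slope a a) (sym Aa≡I) (unit a a)
      ... | no a≢b   = transfer a₀≢b₀ a≢b (∈⇒Slope (lookup⁺ As∈ b))

    equivalence : Σ (List (Matrix F n n)) (λ M → IsNearfieldSpreadSet F M
      × Σ (V → V) (λ f → IsCollineation F f × MapsSpreadOnto F f S (InSr F r M)))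
    equivalence = spreadSet , isNearfieldSpreadSet , coordinates
      , linearBijection⇒collineation coordinates combine coordinates-linear coordinates-combine combine-coordinates
      , element⇒InSr , InSr⇒element

theorem3p1 : (F : FiniteField) (n r : ℕ) → n ≥ 1 → r > 2 →
    (m : ℕ) (S : Fin m → Matrix F n (r * n)) → IsSpread F S →
    (e : Fin r → Fin m) → (∀ i → IsNormal F S (e i)) → InGeneralPosition F S e →
    Σ (List (Matrix F n n)) (λ M → IsNearfieldSpreadSet F M
    × Σ (Vector F (r * n) → Vector F (r * n)) (λ f →
    IsCollineation F f × MapsSpreadOnto F f S (InSr F r M)))
theorem3p1 F n@(suc _) r@(suc (suc (suc _))) _ r>2@(s≤s (s≤s (s≤s _))) m S isSpread e normal (_ , spanning) =
  -- Any two distinct coordinates could define the spread set, since all the slope sets coincide.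
  C₂.Normalised.equivalence r>2 x₁≢𝟎 unit {zero} {suc zero} (λ ())
  where
  open FiniteField F using (1#; 0≢1)
  open LinearAlgebra F

  -- Choice of bases that turns one element into `(I , … , I)`.

  x₁ : Vector F n
  x₁ = replicate _ 1#

  x₁≢𝟎 : x₁ ≢ 𝟎
  x₁≢𝟎 eq = 0≢1 (sym (Vecₚ.∷-injectiveˡ eq))

  module C₁ = Coordinates F S isSpread e normal (λ a → S (e a)) (λ a x → x , refl) (λ a x → x , refl) spanning

  abstract
    -- No coordinate of this vector is zero, so every component of its element is nonsingular and
    -- can be absorbed into the bases.
    diagonal : ∃ λ k → ∃ λ v → C₁._∈ₛ_ v k × (∀ c → C₁.γ v c ≡ x₁)
    diagonal = C₁.realise (λ _ → x₁) {zero} x₁≢𝟎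

  k₀ : Fin m
  k₀ = proj₁ diagonal

  C : Fin r → Matrix F n n
  C = C₁.component k₀

  C-inverse : ∀ a → Nonsingular F (C a)
  C-inverse a = let _ , v , v∈k₀ , γv≡x₁ = diagonal in
    C₁.component-nonsingular (v , v∈k₀ , λ eq → x₁≢𝟎 (trans (sym (γv≡x₁ a)) eq))

  B : Fin r → Matrix F n (r * n)
  B a = _*M_ F (C a) (S (e a))

  rebase : ∀ a x → x ∙ S (e a) ≡ (x ∙ proj₁ (C-inverse a)) ∙ B a
  rebase a x = let D , _ , DC≡I = C-inverse a in
    trans (cong (_∙ S (e a)) (sym (∙-inverse {A = D} {C a} DC≡I x))) (sym (∙-*M (x ∙ D) (C a) (S (e a))))

  rebased-spanning : ∀ v → Σ (Fin r → Vector F n) (λ x → v ≡ sumV F (λ a → x a ∙ B a))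
  rebased-spanning v = let x , v≡ = spanning v in
    (λ a → x a ∙ proj₁ (C-inverse a)) , trans v≡ (sumV-cong (λ a → rebase a (x a)))

  module C₂ = Coordinates F S isSpread e normal B
    (λ a x → x ∙ C a , ∙-*M x (C a) (S (e a)))
    (λ a x → x ∙ proj₁ (C-inverse a) , rebase a x)
    rebased-spanning

  -- In the old bases `x ∙ S k₀` is the sum of the `(x ∙ C a) ∙ S (e a)`, which are the `x ∙ B a`.
  -- So `k₀` becomes `(I , … , I)` in the new ones.
  γ-diagonal : ∀ x a → C₂.γ (x ∙ S k₀) a ≡ x
  γ-diagonal x a = trans (cong (λ v → C₂.γ v a) expansion) (C₂.γ-assemble (λ _ → x) a)
    where
    expansion : x ∙ S k₀ ≡ C₂.assemble (λ _ → x)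
    expansion = trans (C₁.γ-expand (x ∙ S k₀)) (trans
      (sumV-cong (λ b → trans (cong (_∙ S (e b)) (sym (C₁.∙-component x k₀ b))) (sym (∙-*M x (C b) (S (e b))))))
      (sym (C₂.assemble-sum (λ _ → x))))

  unit : ∀ a b → C₂.Slope a b (idM F)
  unit a b = k₀ , (x₁ ∙ S k₀ , (x₁ , refl) , λ eq → x₁≢𝟎 (trans (sym (γ-diagonal x₁ a)) eq)) ,
    λ { _ (x , refl) → trans (γ-diagonal x b) (trans (sym (γ-diagonal x a)) (sym (∙-idM _))) }
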